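{- $\mathcal{C}_2(8,4,3)\le 6897$.
   Context: $\mathcal{C}_q(n,k,r)$ is the minimum number of $k$-dimensional subspaces of $\mathbb{F}_q^n$ such that every $r$-dimensional subspace of $\mathbb{F}_q^n$ is contained in at least one of them. -}

module Defs where

open import Algebra.Bundles using (CommutativeRing)
open import Data.Bool.Base using (Bool; true; false)
open import Data.Bool.Properties using (xor-∧-commutativeRing)
open import Data.Empty using (⊥-elim)
open import Data.Fin.Base using (Fin)
open import Data.Fin.Properties using (2↔Bool)
open import Data.Nat.Base using (ℕ; _≤_)
open import Data.Product.Base using (Σ-syntax; ∃-syntax; _×_; _,_; proj₁)
open import Data.Vec.Functional using (Vector; replicate; map; zipWith)
open import Function.Bundles using (Inverse)
open import Level using (0ℓ)
open import Relation.Binary.PropositionalEquality using (_≡_; refl) renaming (setoid to ≡-setoid)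
open import Relation.Nullary using (¬_)
open import Relation.Unary using (Pred; _∈_; _⊆_; _≐_)

record FiniteField (q : ℕ) : Set₁ where
  field
    commutativeRing : CommutativeRing 0ℓ 0ℓ
  open CommutativeRing commutativeRing public
  field
    0≉1         : ¬ (0# ≈ 1#)
    inverse     : ∀ x → ¬ (x ≈ 0#) → ∃[ y ] x * y ≈ 1#
    enumeration : Inverse (≡-setoid (Fin q)) setoid

-- Bool with exclusive or as addition and conjunction as multiplication.
𝔽₂ : FiniteField 2
𝔽₂ = record
  { commutativeRing = xor-∧-commutativeRing
  ; 0≉1             = λ ()
  ; inverse         = λ { true _ → true , refl ; false x≉0 → ⊥-elim (x≉0 refl) }
  ; enumeration     = 2↔Bool
  }

module _ {q : ℕ} (F : FiniteField q) where
  private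
    module F = FiniteField F
  open import Algebra.Properties.Monoid.Sum F.+-monoid using (sum)
  open import Data.Vec.Functional.Relation.Binary.Equality.Setoid F.setoid using (_≋_)

  V : ℕ → Set
  V n = Vector F.Carrier n

  linearCombination : ∀ {n k} → (Fin k → F.Carrier) → (Fin k → V n) → V n
  linearCombination c b j = sum (λ i → c i F.* b i j)

  LinearlyIndependent : ∀ {n k} → (Fin k → V n) → Set
  LinearlyIndependent {n} b =
    ∀ c → linearCombination c b ≋ replicate n F.0# → ∀ i → c i F.≈ F.0#

  record IsSubspace {n : ℕ} (U : Pred (V n) 0ℓ) : Set where
    field
      resp     : ∀ {x y} → x ≋ y → x ∈ U → y ∈ U
      0-closed : replicate n F.0# ∈ U
      +-closed : ∀ {x y} → x ∈ U → y ∈ U → zipWith F._+_ x y ∈ U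
      *-closed : ∀ a {x} → x ∈ U → map (a F.*_) x ∈ U

  record IsBasis {n k : ℕ} (U : Pred (V n) 0ℓ) (b : Fin k → V n) : Set where
    field
      members     : ∀ i → b i ∈ U
      independent : LinearlyIndependent b
      spanning    : ∀ {x} → x ∈ U → ∃[ c ] linearCombination c b ≋ x

  HasDimension : ∀ {n} → Pred (V n) 0ℓ → ℕ → Set
  HasDimension {n} U k = Σ[ b ∈ (Fin k → V n) ] IsBasis U b

  Subspace : (n k : ℕ) → Set₁
  Subspace n k = Σ[ U ∈ Pred (V n) 0ℓ ] IsSubspace U × HasDimension U k

  -- A set of exactly m subspaces, given as an injective family indexed by Fin m.
  record IsCovering (n k r : ℕ) {m : ℕ} (S : Fin m → Subspace n k) : Set₁ where
    field
      distinct : ∀ i j → proj₁ (S i) ≐ proj₁ (S j) → i ≡ j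
      covers   : (T : Subspace n r) → ∃[ i ] proj₁ T ⊆ proj₁ (S i)

  HasCovering : (n k r m : ℕ) → Set₁
  HasCovering n k r m = Σ[ S ∈ (Fin m → Subspace n k) ] IsCovering n k r S

  -- 𝒞_q(n,k,r) = m.  It is a relation because no covering exists for some n, k, r.
  record IsCoveringNumber (n k r m : ℕ) : Set₁ where
    field
      attained : HasCovering n k r m
      minimal  : ∀ m′ → HasCovering n k r m′ → m ≤ m′

{-# OPTIONS --safe #-}
-- Write 𝔽₂⁸ = 𝔽₁₆ × 𝔽₁₆.  The covering consists of
--   * the 4096 graphs of the linearized polynomials a x + b x² + c x⁴ over 𝔽₁₆;
--   * the 2800 spaces that project onto a line L of the first factor and meet the fibre 0 × 𝔽₁₆ in
--     a line M, where L and M belong to the same class of a fixed parallelism of PG(3,2): 35 choices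
--     of L, 5 of M, and 16 linear maps L → 𝔽₁₆ / M;
--   * the fibre itself.
-- A 3-space T that projects injectively lies in a graph by interpolation.  If its projection has
-- dimension 2, take L to be the projection and M the line parallel to L through the point in which T
-- meets the fibre; if it has dimension 1, take M to be the intersection of T with the fibre and L the
-- line parallel to M through the projection.
-- The minimum itself exists because being a covering can be decided on bases.
module Submission where

open import Defs
open import Algebra.Bundles using (CommutativeRing)
open import Data.Bool.Base using (Bool; true; false; if_then_else_; _∧_; _xor_)
open import Data.Bool.Properties using (xor-∧-commutativeRing; xor-identityʳ) renaming (_≟_ to _≟ᵇ_)
open import Data.Fin.Base using (Fin; zero; suc; toℕ; punchIn; punchOut; _↑ˡ_; _↑ʳ_)
open import Data.Fin.Patterns
open import Data.Fin.Properties using (any?; all?; punchIn-punchOut; 1↔⊤; 2↔Bool; *↔×; +↔⊎) renaming (_≟_ to _≟ᶠ_)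
open import Data.Fin.Subset.Properties using (anySubset?)
open import Data.Nat.Base as ℕ using (ℕ; zero; suc; _^_; _≤_; z≤n; s≤s)
open import Data.Nat.Properties using (<-irrefl)
open import Data.Product.Base using (Σ-syntax; ∃-syntax; _×_; _,_; proj₁; proj₂; uncurry; map)
open import Data.Product.Function.NonDependent.Propositional using (_×-↔_)
open import Data.Sum.Base using (_⊎_; inj₁; inj₂; [_,_]′)
open import Data.Sum.Function.Propositional using (_⊎-↔_)
open import Data.Unit.Base using (⊤; tt)
open import Data.Vec.Base using (Vec; []; _∷_; _++_; head; tail; lookup; replicate; tabulate; zipWith; _[_]≔_)
open import Data.Vec.Properties using (≡-dec; lookup-zipWith; zipWith-++; lookup-replicate; tabulate-cong)
open import Function.Base using (_∘_)
open import Function.Bundles using (_↔_; mk↔ₛ′; Inverse)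
open import Function.Construct.Composition using (_↔-∘_)
open import Function.Construct.Identity using (↔-id)
open import Level using (0ℓ)
open import Relation.Binary.Bundles using (Setoid)
open import Relation.Binary.Definitions using (_Respects_)
open import Relation.Binary.PropositionalEquality using (_≡_; _≢_; refl; sym; trans; cong; cong₂; subst; subst₂)
open import Relation.Nullary using (Dec; yes; no; ¬?; contradiction; decidable-stable; map′; _→-dec_; _×-dec_; _⊎-dec_)
open import Relation.Nullary.Decidable using (from-yes)
open import Relation.Unary using (Pred; Decidable; _∈_; _⊆_)
import Algebra.Properties.CommutativeSemigroup as CommutativeSemigroupProperties
import Data.Vec.Functional as Vector
import Data.Vec.Functional.Relation.Binary.Equality.Setoid as VectorEquality

-- Exhaustive search in finite setoids

-- Only predicates that respect the equality are searched, because vectors are functions and an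
-- enumeration reaches them up to pointwise equality.
Searchable : Setoid 0ℓ 0ℓ → Set₁
Searchable S = {P : Pred Carrier 0ℓ} → P Respects _≈_ → Decidable P → Dec (∃[ x ] P x)
  where open Setoid S

module _ (S : Setoid 0ℓ 0ℓ) (search : Searchable S) where
  open Setoid S renaming (refl to ≈-refl; sym to ≈-sym)
  open VectorEquality S using (≋-setoid)

  searchable-all? : {P : Pred Carrier 0ℓ} → P Respects _≈_ → Decidable P → Dec (∀ x → P x)
  searchable-all? resp P? with search (λ x≈y ¬Px Py → ¬Px (resp (≈-sym x≈y) Py)) (¬? ∘ P?)
  ... | yes (x , ¬Px) = no λ ∀P → ¬Px (∀P x)
  ... | no ¬∃¬P       = yes λ x → decidable-stable (P? x) λ ¬Px → ¬∃¬P (x , ¬Px)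

  vector-searchable : ∀ n → Searchable (≋-setoid n)
  vector-searchable zero    resp P? =
    map′ (Vector.[] ,_) (λ (xs , Pxs) → resp (λ ()) Pxs) (P? Vector.[])
  vector-searchable (suc n) {P} resp P? =
    map′ (λ (x , xs , Pxxs) → x Vector.∷ xs , Pxxs)
         (λ (xs , Pxs) → Vector.head xs , Vector.tail xs , resp (λ { zero → ≈-refl ; (suc i) → ≈-refl }) Pxs)
         (search (λ x≈y (xs , Pxxs) → xs , resp (λ { zero → x≈y ; (suc i) → ≈-refl }) Pxxs)
                 (λ x → vector-searchable n
                          (λ xs≋ys → resp (λ { zero → ≈-refl ; (suc i) → xs≋ys i }))
                          (λ xs → P? (x Vector.∷ xs))))

-- The known witness bounds an upward search from 0; each step shifts the predicate by one.
least : ∀ {p} {P : ℕ → Set p} → Decidable P → ∀ {N} → P N →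
        ∃[ m ] P m × (∀ m′ → P m′ → m ≤ m′) × m ≤ N
least P? {zero}  P0 = 0 , P0 , (λ _ _ → z≤n) , z≤n
least P? {suc N} PN with P? 0
... | yes P0 = 0 , P0 , (λ _ _ → z≤n) , z≤n
... | no ¬P0 with m , Pm , minimal , m≤N ← least (P? ∘ suc) PN =
  suc m , Pm , (λ { zero P0 → contradiction P0 ¬P0 ; (suc m′) Pm′ → s≤s (minimal m′ Pm′) }) , s≤s m≤N

-- Decidable linear algebra over a finite field

module _ {q : ℕ} (F : FiniteField q) where
  private module F = FiniteField F
  open FiniteField F hiding (zero; refl; sym; trans)
  open import Algebra.Properties.Semiring.Sum F.semiring
    using (sum; sum-cong-≋; sum-replicate-zero; ∑-distrib-+; *-distribˡ-sum)
  open VectorEquality F.setoid using (_≋_; ≋-setoid; ≋-sym; ≋-trans)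

  carrier-searchable : Searchable setoid
  carrier-searchable resp P? =
    map′ (λ (i , Pi) → to i , Pi)
         (λ (x , Px) → from x , resp (F.sym (strictlyInverseˡ x)) Px)
         (any? (P? ∘ to))
    where open Inverse enumeration

  _≈?_ : ∀ x y → Dec (x ≈ y)
  x ≈? y = map′ (λ eq → F.trans (F.sym (strictlyInverseˡ x))
                          (F.trans (F.reflexive (cong to eq)) (strictlyInverseˡ y)))
                from-cong (from x ≟ᶠ from y)
    where open Inverse enumeration

  _≋?_ : ∀ {n} (x y : V F n) → Dec (x ≋ y)
  x ≋? y = all? λ i → x i ≈? y i

  familySetoid : (n k : ℕ) → Setoid 0ℓ 0ℓ
  familySetoid n k = VectorEquality.≋-setoid (≋-setoid n) k

  family-searchable : ∀ n k → Searchable (familySetoid n k)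
  family-searchable n k =
    vector-searchable (≋-setoid n) (vector-searchable setoid carrier-searchable n) k

  span : ∀ {n k} → (Fin k → V F n) → Pred (V F n) 0ℓ
  span b x = ∃[ c ] linearCombination F c b ≋ x

  module _ {n k : ℕ} where
    open Setoid (familySetoid n k) using () renaming (_≈_ to _≋≋_; sym to ≋≋-sym)

    linearCombination-cong : ∀ {c c′} {b b′ : Fin k → V F n} → c ≋ c′ → b ≋≋ b′ →
                             linearCombination F c b ≋ linearCombination F c′ b′
    linearCombination-cong c≋c′ b≋b′ j = sum-cong-≋ λ i → *-cong (c≋c′ i) (b≋b′ i j)

    independent-resp : (LinearlyIndependent F {n} {k}) Respects _≋≋_
    independent-resp b≋b′ ind c eq =
      ind c (≋-trans (linearCombination-cong (λ _ → F.refl) b≋b′) eq)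

    span-resp : ∀ {b b′ : Fin k → V F n} {x y} → b ≋≋ b′ → x ≋ y → x ∈ span b → y ∈ span b′
    span-resp b≋b′ x≋y (c , eq) =
      c , ≋-trans (linearCombination-cong (λ _ → F.refl) (≋≋-sym b≋b′)) (≋-trans eq x≋y)

    span? : (b : Fin k → V F n) → Decidable (span b)
    span? b x = vector-searchable setoid carrier-searchable k
      (λ c≋c′ → ≋-trans (linearCombination-cong (≋-sym c≋c′) (λ _ _ → F.refl)))
      (λ c → linearCombination F c b ≋? x)

    independent? : Decidable (LinearlyIndependent F {n} {k})
    independent? b = searchable-all? (≋-setoid k) (vector-searchable setoid carrier-searchable k)
      (λ c≋c′ ind eq i → F.trans (F.sym (c≋c′ i))
         (ind (≋-trans (linearCombination-cong c≋c′ (λ _ _ → F.refl)) eq) i))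
      (λ c → (linearCombination F c b ≋? Vector.replicate n 0#) →-dec all? λ i → c i ≈? 0#)

    span-isSubspace : (b : Fin k → V F n) → IsSubspace F (span b)
    span-isSubspace b = record
      { resp     = λ x≋y → span-resp (λ _ _ → F.refl) x≋y
      ; 0-closed = Vector.replicate k 0# ,
                   λ j → F.trans (sum-cong-≋ (λ i → zeroˡ (b i j))) (sum-replicate-zero k)
      ; +-closed = λ (c , eq) (c′ , eq′) → Vector.zipWith _+_ c c′ , λ j →
                   F.trans (sum-cong-≋ (λ i → distribʳ (b i j) (c i) (c′ i)))
                  (F.trans (∑-distrib-+ (λ i → c i * b i j) (λ i → c′ i * b i j))
                           (+-cong (eq j) (eq′ j)))
      ; *-closed = λ a (c , eq) → Vector.map (a *_) c , λ j →
                   F.trans (sum-cong-≋ (λ i → *-assoc a (c i) (b i j)))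
                  (F.trans (F.sym (*-distribˡ-sum a (λ i → c i * b i j)))
                           (*-congˡ (eq j)))
      }

  linearCombination-closed : ∀ {n k} {U : Pred (V F n) 0ℓ} → IsSubspace F U →
    (c : Fin k → Carrier) (b : Fin k → V F n) → (∀ i → b i ∈ U) → linearCombination F c b ∈ U
  linearCombination-closed {k = zero}  U-sub c b b∈U = IsSubspace.0-closed U-sub
  linearCombination-closed {k = suc k} U-sub c b b∈U =
    +-closed (*-closed (c zero) (b∈U zero))
             (linearCombination-closed U-sub (c ∘ suc) (b ∘ suc) (b∈U ∘ suc))
    where open IsSubspace U-sub

  basis⊆⇒⊆ : ∀ {n k} {U W : Pred (V F n) 0ℓ} {b : Fin k → V F n} →
             IsBasis F U b → IsSubspace F W → (∀ i → b i ∈ W) → U ⊆ W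
  basis⊆⇒⊆ {b = b} U-basis W-sub b∈W x∈U with c , eq ← IsBasis.spanning U-basis x∈U =
    IsSubspace.resp W-sub eq (linearCombination-closed W-sub c b b∈W)

  basis-member : ∀ {n k} (b : Fin k → V F n) i → b i ∈ span b
  basis-member {k = suc k} b zero = (λ { zero → 1# ; (suc _) → 0# }) , λ j →
    F.trans (+-cong (*-identityˡ _)
      (F.trans (sum-cong-≋ (λ i → zeroˡ (b (suc i) j))) (sum-replicate-zero k)))
      (+-identityʳ _)
  basis-member b (suc i) with c , eq ← basis-member (b ∘ suc) i =
    (λ { zero → 0# ; (suc l) → c l }) , λ j →
    F.trans (+-cong (zeroˡ _) (eq j)) (+-identityˡ _)

  spanSubspace : ∀ {n k} (b : Fin k → V F n) → LinearlyIndependent F b → Subspace F n k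
  spanSubspace b ind = span b , span-isSubspace b , b , record
    { members     = basis-member b
    ; independent = ind
    ; spanning    = λ x∈U → x∈U
    }

  -- Coverings given by bases and existence of the covering number

  module _ (n k r : ℕ) where

    -- Independent r-tuples stand for r-dimensional subspaces, since a subspace that contains a
    -- basis of T contains T. The index type is free so that a concrete covering can keep a
    -- structured index.
    CoversIndependent : {A : Set} → (A → Fin k → V F n) → Set
    CoversIndependent B =
      (d : Fin r → V F n) → LinearlyIndependent F d → ∃[ i ] (∀ j → d j ∈ span (B i))

    -- A covering given by bases, with repetitions allowed.  Unlike HasCovering this does not
    -- quantify over predicates, so it is decidable.
    BasisCovering : ℕ → Set
    BasisCovering m =
      Σ[ B ∈ (Fin m → Fin k → V F n) ] (∀ i → LinearlyIndependent F (B i)) × CoversIndependent B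

    reindex : ∀ {m} {A : Set} → Fin m ↔ A → (B : A → Fin k → V F n) →
              (∀ a → LinearlyIndependent F (B a)) → CoversIndependent B → BasisCovering m
    reindex index B ind cov = B ∘ to , ind ∘ to , λ d d-ind →
      let a , d∈ = cov d d-ind in
      from a , subst (λ a → ∀ j → d j ∈ span (B a)) (sym (strictlyInverseˡ a)) d∈
      where open Inverse index

    -- Every quantifier ranges over a finite setoid, so nested search decides; what remains is
    -- invariance under pointwise equality.
    basisCovering? : Decidable BasisCovering
    basisCovering? m =
      vector-searchable (familySetoid n k) (family-searchable n k) m
        (λ B≋B′ (ind , cov) →
          (λ i → independent-resp (B≋B′ i) (ind i)) ,
          (λ d d-ind → let i , d∈ = cov d d-ind in
             i , λ j → span-resp (B≋B′ i) (λ _ → F.refl) (d∈ j)))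
        (λ B → all? (λ i → independent? (B i)) ×-dec
          searchable-all? (familySetoid n r) (family-searchable n r)
            (λ {d} {d′} d≋d′ cov d-ind →
               let i , d∈ = cov (independent-resp (λ i j → F.sym (d≋d′ i j)) d-ind) in
               i , λ j → span-resp (λ _ _ → F.refl) (d≋d′ j) (d∈ j))
            (λ d → independent? d →-dec any? λ i → all? λ j → span? (B i) (d j)))

    covering⇒basisCovering : ∀ {m} → HasCovering F n k r m → BasisCovering m
    covering⇒basisCovering (S , S-covering) =
      (λ i → proj₁ (dim i)) ,
      (λ i → IsBasis.independent (proj₂ (dim i))) ,
      (λ d d-ind → let i , d⊆ = IsCovering.covers S-covering (spanSubspace d d-ind) in
         i , λ j → IsBasis.spanning (proj₂ (dim i)) (d⊆ (basis-member d j)))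
      where
      dim : ∀ i → HasDimension F (proj₁ (S i)) k
      dim i = proj₂ (proj₂ (S i))

    -- A member of a smallest covering that is contained in another one could be dropped.
    minimal⇒distinct : ∀ {m} ((B , _) : BasisCovering m) → (∀ m′ → BasisCovering m′ → m ≤ m′) →
                       ∀ i j → span (B i) ⊆ span (B j) → i ≡ j
    minimal⇒distinct {suc m} (B , ind , cov) minimal i j Bi⊆Bj with i ≟ᶠ j
    ... | yes i≡j = i≡j
    ... | no  i≢j =
      -- Without member `i` there remain `m` members, fewer than the minimum `suc m`.
      contradiction (minimal m (B ∘ punchIn i , ind ∘ punchIn i , cov′)) (<-irrefl refl)
      where
      avoiding : ∀ {l} {d : Fin r → V F n} → i ≢ l → (∀ t → d t ∈ span (B l)) →
                 ∃[ l′ ] (∀ t → d t ∈ span (B (punchIn i l′)))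
      avoiding {d = d} i≢l d∈ = punchOut i≢l ,
        subst (λ l → ∀ t → d t ∈ span (B l)) (sym (punchIn-punchOut i≢l)) d∈

      cov′ : CoversIndependent (B ∘ punchIn i)
      cov′ d d-ind with cov d d-ind
      ... | l , d∈ with i ≟ᶠ l
      -- What member `i` covers is also covered by member `j`, which survives the removal.
      ...   | yes refl = avoiding {d = d} i≢j (λ t → Bi⊆Bj (d∈ t))
      ...   | no  i≢l  = avoiding {d = d} i≢l d∈

    minimal⇒covering : ∀ {m} → BasisCovering m → (∀ m′ → BasisCovering m′ → m ≤ m′) →
                       HasCovering F n k r m
    minimal⇒covering {m} C@(B , ind , cov) minimal = S , record
      { distinct = λ i j (Bi⊆Bj , _) → minimal⇒distinct C minimal i j Bi⊆Bj
      ; covers   = covers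
      }
      where
      S : Fin m → Subspace F n k
      S i = spanSubspace (B i) (ind i)

      covers : (T : Subspace F n r) → ∃[ i ] proj₁ T ⊆ proj₁ (S i)
      covers (T , _ , d , T-basis) with i , d∈ ← cov d (IsBasis.independent T-basis) =
        i , basis⊆⇒⊆ T-basis (span-isSubspace (B i)) d∈

    -- The least sizes of both kinds of covering agree: a smallest basis covering is a covering, and
    -- every covering yields a basis covering of its size.
    basisCovering⇒coveringNumber≤ : ∀ {N} → BasisCovering N →
                                    ∃[ m ] (IsCoveringNumber F n k r m × m ≤ N)
    basisCovering⇒coveringNumber≤ cov
      with m , covₘ , minimal , m≤N ← least basisCovering? cov =
      m , record { attained = minimal⇒covering covₘ minimal
                 ; minimal  = λ m′ → minimal m′ ∘ covering⇒basisCovering } , m≤N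

-- The field 𝔽₁₆ and its linearized polynomials

pattern O = false
pattern I = true

-- A subset of `Fin n` is a vector of `n` bits, so `anySubset?` searches all of them.
allVec? : ∀ {n} {P : Pred (Vec Bool n) 0ℓ} → Decidable P → Dec (∀ x → P x)
allVec? P? = map′ (λ ¬∃¬P x → decidable-stable (P? x) λ ¬Px → ¬∃¬P (x , ¬Px))
                  (λ ∀P (x , ¬Px) → ¬Px (∀P x))
                  (¬? (anySubset? (¬? ∘ P?)))

W : Set
W = Vec Bool 4

allW? : {P : Pred W 0ℓ} → Decidable P → Dec (∀ x → P x)
allW? = allVec?

infixl 6 _⊕_
infixr 7 _⊙_ _·_
infix 8 _²
infix 4 _≟_

_≟_ : ∀ {n} (x y : Vec Bool n) → Dec (x ≡ y)
_≟_ = ≡-dec _≟ᵇ_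

_⊕_ : ∀ {n} → Vec Bool n → Vec Bool n → Vec Bool n
_⊕_ = zipWith _xor_

𝟘 : W
𝟘 = replicate 4 false

𝟙 : W
𝟙 = I ∷ O ∷ O ∷ O ∷ []

_⊙_ : Bool → W → W
α ⊙ x = if α then x else 𝟘

⊕-interchange : ∀ {n} (a b c d : Vec Bool n) → (a ⊕ b) ⊕ (c ⊕ d) ≡ (a ⊕ c) ⊕ (b ⊕ d)
⊕-interchange []       []       []       []       = refl
⊕-interchange (a ∷ as) (b ∷ bs) (c ∷ cs) (d ∷ ds) =
  cong₂ _∷_ (interchange a b c d) (⊕-interchange as bs cs ds)
  where
  open CommutativeSemigroupProperties
    (CommutativeRing.+-commutativeSemigroup xor-∧-commutativeRing)

⊕-identityˡ : (x : W) → 𝟘 ⊕ x ≡ x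
⊕-identityˡ = from-yes (allW? λ x → 𝟘 ⊕ x ≟ x)

⊕-identityʳ : (x : W) → x ⊕ 𝟘 ≡ x
⊕-identityʳ = from-yes (allW? λ x → x ⊕ 𝟘 ≟ x)

⊕-cancelˡ : (x y : W) → x ⊕ (x ⊕ y) ≡ y
⊕-cancelˡ = from-yes (allW? λ x → allW? λ y → x ⊕ (x ⊕ y) ≟ y)

⊕-cancelʳ : (x y : W) → (x ⊕ y) ⊕ y ≡ x
⊕-cancelʳ = from-yes (allW? λ x → allW? λ y → (x ⊕ y) ⊕ y ≟ x)

-- Multiplication by z in 𝔽₁₆ = 𝔽₂[z]/(z⁴ + z + 1), coefficients listed from the constant term.
z·_ : W → W
z· (a ∷ b ∷ c ∷ d ∷ []) = d ∷ (a xor d) ∷ b ∷ c ∷ []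

-- Horner's scheme for the first factor a + bz + cz² + dz³.
_·_ : W → W → W
(a ∷ b ∷ c ∷ d ∷ []) · y = a ⊙ y ⊕ z· (b ⊙ y ⊕ z· (c ⊙ y ⊕ z· (d ⊙ y)))

_² : W → W
x ² = x · x

·-assoc : ∀ x y z → (x · y) · z ≡ x · (y · z)
·-assoc = from-yes (allW? λ x → allW? λ y → allW? λ z → (x · y) · z ≟ x · (y · z))

·-distribˡ-⊕ : ∀ x y z → x · (y ⊕ z) ≡ x · y ⊕ x · z
·-distribˡ-⊕ = from-yes (allW? λ x → allW? λ y → allW? λ z → x · (y ⊕ z) ≟ x · y ⊕ x · z)

·-distribʳ-⊕ : ∀ x y z → (y ⊕ z) · x ≡ y · x ⊕ z · x
·-distribʳ-⊕ = from-yes (allW? λ x → allW? λ y → allW? λ z → (y ⊕ z) · x ≟ y · x ⊕ z · x)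

·-identityʳ : ∀ x → x · 𝟙 ≡ x
·-identityʳ = from-yes (allW? λ x → x · 𝟙 ≟ x)

·-zeroʳ : ∀ x → x · 𝟘 ≡ 𝟘
·-zeroʳ = from-yes (allW? λ x → x · 𝟘 ≟ 𝟘)

²-⊕ : ∀ x y → (x ⊕ y) ² ≡ x ² ⊕ y ²
²-⊕ = from-yes (allW? λ x → allW? λ y → (x ⊕ y) ² ≟ x ² ⊕ y ²)

-- (a , b , c) stands for the linearized polynomial a x + b x² + c x⁴.
Poly : Set
Poly = W × W × W

eval : Poly → W → W
eval (a , b , c) x = (a · x ⊕ b · x ²) ⊕ c · (x ²) ²

_⊞_ : Poly → Poly → Poly
(a , b , c) ⊞ (a′ , b′ , c′) = a ⊕ a′ , b ⊕ b′ , c ⊕ c′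

scale : W → Poly → Poly
scale e (a , b , c) = e · a , e · b , e · c

⊕-interchange₃ : ∀ {n} (a b c a′ b′ c′ : Vec Bool n) →
  ((a ⊕ a′) ⊕ (b ⊕ b′)) ⊕ (c ⊕ c′) ≡ ((a ⊕ b) ⊕ c) ⊕ ((a′ ⊕ b′) ⊕ c′)
⊕-interchange₃ a b c a′ b′ c′ =
  trans (cong (_⊕ (c ⊕ c′)) (⊕-interchange a a′ b b′)) (⊕-interchange (a ⊕ b) (a′ ⊕ b′) c c′)

-- Squaring is the Frobenius map in characteristic 2, so each of the three terms is additive.
eval-⊕ : ∀ f x y → eval f (x ⊕ y) ≡ eval f x ⊕ eval f y
eval-⊕ (a , b , c) x y = trans
  (cong₂ _⊕_
    (cong₂ _⊕_ (·-distribˡ-⊕ a x y)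
               (trans (cong (b ·_) (²-⊕ x y)) (·-distribˡ-⊕ b (x ²) (y ²))))
    (trans (cong (c ·_) (trans (cong _² (²-⊕ x y)) (²-⊕ (x ²) (y ²))))
           (·-distribˡ-⊕ c ((x ²) ²) ((y ²) ²))))
  (⊕-interchange₃ (a · x) (b · x ²) (c · (x ²) ²) (a · y) (b · y ²) (c · (y ²) ²))

eval-⊞ : ∀ f g x → eval (f ⊞ g) x ≡ eval f x ⊕ eval g x
eval-⊞ (a , b , c) (a′ , b′ , c′) x = trans
  (cong₂ _⊕_ (cong₂ _⊕_ (·-distribʳ-⊕ x a a′) (·-distribʳ-⊕ (x ²) b b′))
             (·-distribʳ-⊕ ((x ²) ²) c c′))
  (⊕-interchange₃ (a · x) (b · x ²) (c · (x ²) ²) (a′ · x) (b′ · x ²) (c′ · (x ²) ²))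

eval-scale : ∀ e f x → eval (scale e f) x ≡ e · eval f x
eval-scale e (a , b , c) x = trans
  (cong₂ _⊕_ (cong₂ _⊕_ (·-assoc e a x) (·-assoc e b (x ²))) (·-assoc e c ((x ²) ²)))
  (sym (trans (·-distribˡ-⊕ e (a · x ⊕ b · x ²) (c · (x ²) ²))
              (cong (_⊕ e · c · (x ²) ²) (·-distribˡ-⊕ e (a · x) (b · x ²)))))

eval-𝟘 : ∀ f → eval f 𝟘 ≡ 𝟘
eval-𝟘 (a , b , c) = cong₂ _⊕_ (cong₂ _⊕_ (·-zeroʳ a) (·-zeroʳ b)) (·-zeroʳ c)

eval-⊙ : ∀ f α x → eval f (α ⊙ x) ≡ α ⊙ eval f x
eval-⊙ f true  x = refl
eval-⊙ f false x = eval-𝟘 f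

comb : Vec Bool 2 → W × W → W
comb (α ∷ β ∷ []) (p , q) = α ⊙ p ⊕ β ⊙ q

-- The pair may be dependent: `⟨ 𝟘 , 𝟘 ⟩` is the zero space and `⟨ x , 𝟘 ⟩` the span of one vector.
⟨_⟩ : W × W → Pred W 0ℓ
⟨ l ⟩ x = ∃[ s ] x ≡ comb s l

⟨_⟩? : ∀ l → Decidable ⟨ l ⟩
⟨ l ⟩? x = anySubset? λ s → x ≟ comb s l

infix 8 _⁻¹

-- The power v¹⁴, which inverts nonzero v because the multiplicative group has order 15.
_⁻¹ : W → W
v ⁻¹ = v ² · (v ²) ² · ((v ²) ²) ²

opaque
  ⁻¹-inverse : ∀ v → v ≡ 𝟘 ⊎ v ⁻¹ · v ≡ 𝟙
  ⁻¹-inverse = from-yes (allW? λ v → (v ≟ 𝟘) ⊎-dec (v ⁻¹ · v ≟ 𝟙))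

-- The product of the z + u over u in ⟨ p , q ⟩.
annihilator : W → W → Poly
annihilator p q = p ² · q ⊕ p · q ² , (p ² ⊕ p · q) ⊕ q ² , 𝟙

opaque
  annihilator-zeroˡ : ∀ p q → eval (annihilator p q) p ≡ 𝟘
  annihilator-zeroˡ = from-yes (allW? λ p → allW? λ q → eval (annihilator p q) p ≟ 𝟘)

opaque
  annihilator-zeroʳ : ∀ p q → eval (annihilator p q) q ≡ 𝟘
  annihilator-zeroʳ = from-yes (allW? λ p → allW? λ q → eval (annihilator p q) q ≟ 𝟘)

opaque
  -- A product in a field vanishes only if one of its factors x + u, with u in the span, does.
  annihilator-root : ∀ p q x → eval (annihilator p q) x ≡ 𝟘 → x ∈ ⟨ p , q ⟩
  annihilator-root = from-yes (allW? λ p → allW? λ q → allW? λ x →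
    (eval (annihilator p q) x ≟ 𝟘) →-dec ⟨ p , q ⟩? x)

-- A Newton basis polynomial: adding a multiple of it corrects the value at `x` and keeps the values
-- at `p` and `q`.
Separator : W → W → W → Set
Separator x p q = ∃[ f ] (eval f x ≡ 𝟙 × eval f p ≡ 𝟘 × eval f q ≡ 𝟘)

opaque
  -- If the annihilator of the span is nonzero at `x`, dividing it by that value gives a separator.
  separate : ∀ x p q → x ∈ ⟨ p , q ⟩ ⊎ Separator x p q
  separate x p q with ⁻¹-inverse (eval (annihilator p q) x)
  ... | inj₁ v≡𝟘    = inj₁ (annihilator-root p q x v≡𝟘)
  ... | inj₂ v⁻¹v≡𝟙 = inj₂ (scale e f , trans (eval-scale e f x) v⁻¹v≡𝟙 ,
                            vanishing p (annihilator-zeroˡ p q) ,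
                            vanishing q (annihilator-zeroʳ p q))
    where
    f : Poly
    f = annihilator p q
    e : W
    e = eval f x ⁻¹
    vanishing : ∀ y → eval f y ≡ 𝟘 → eval (scale e f) y ≡ 𝟘
    vanishing y fy≡𝟘 = trans (eval-scale e f y) (trans (cong (e ·_) fy≡𝟘) (·-zeroʳ e))

-- A parallelism of PG(3,2)

-- Multiplication by z in 𝔽₈ = 𝔽₂[z]/(z³ + z + 1) on the last three coordinates, with the first
-- coordinate fixed.
rotate : W → W
rotate (a ∷ b ∷ c ∷ d ∷ []) = a ∷ d ∷ (b xor d) ∷ c ∷ []

rotate^ : ℕ → W → W
rotate^ zero    x = x
rotate^ (suc n) x = rotate (rotate^ n x)

spread : Fin 5 → W × W
spread 0F = (O ∷ O ∷ O ∷ I ∷ []) , (O ∷ I ∷ O ∷ O ∷ [])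
spread 1F = (O ∷ O ∷ I ∷ O ∷ []) , (I ∷ I ∷ O ∷ O ∷ [])
spread 2F = (O ∷ O ∷ I ∷ I ∷ []) , (I ∷ O ∷ O ∷ I ∷ [])
spread 3F = (O ∷ I ∷ I ∷ O ∷ []) , (I ∷ O ∷ I ∷ I ∷ [])
spread 4F = (O ∷ I ∷ I ∷ I ∷ []) , (I ∷ O ∷ O ∷ O ∷ [])

-- The images of one spread under an element of order 7 of GL(4,2).
line : Fin 7 → Fin 5 → W × W
line c j = map (rotate^ (toℕ c)) (rotate^ (toℕ c)) (spread j)

opaque
  -- The 7 classes of 5 lines contain each of the 35 lines of PG(3,2) once; dependent `p` and `q`
  -- also share a line.
  line-through : ∀ p q → ∃[ c ] ∃[ j ] (p ∈ ⟨ line c j ⟩ × q ∈ ⟨ line c j ⟩)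
  line-through = from-yes (allW? λ p → allW? λ q → any? λ c → any? λ j →
    ⟨ line c j ⟩? p ×-dec ⟨ line c j ⟩? q)

opaque
  -- Each class is a spread: its five lines partition the 15 points.
  parallel-through : ∀ c p → ∃[ j ] p ∈ ⟨ line c j ⟩
  parallel-through = from-yes (all? λ c → allW? λ p → any? λ j → ⟨ line c j ⟩? p)

-- Any second line of the class serves: two lines of a spread are skew, so they are complementary in
-- 𝔽₂⁴, and the vectors of one represent the cosets of the other.
other : Fin 5 → Fin 5
other zero    = 1F
other (suc _) = 0F

opaque
  complement : ∀ c j y → ∃[ s ] (comb s (line c (other j)) ⊕ y) ∈ ⟨ line c j ⟩
  complement = from-yes (all? λ c → all? λ j → allW? λ y → anySubset? λ s →
    ⟨ line c j ⟩? (comb s (line c (other j)) ⊕ y))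

opaque
  line-independent : ∀ c j s → comb s (line c j) ≡ 𝟘 → s ≡ O ∷ O ∷ []
  line-independent = from-yes (all? λ c → all? λ j → allVec? {2} λ s →
    (comb s (line c j) ≟ 𝟘) →-dec (s ≟ O ∷ O ∷ []))

-- The covering of 𝔽₂⁸

ι : W × W → V 𝔽₂ 8
ι (x , y) = lookup (x ++ y)

eval-comb : ∀ f s p q → eval f (comb s (p , q)) ≡ comb s (eval f p , eval f q)
eval-comb f (α ∷ β ∷ []) p q =
  trans (eval-⊕ f (α ⊙ p) (β ⊙ q)) (cong₂ _⊕_ (eval-⊙ f α p) (eval-⊙ f β q))

opaque
  comb-𝟘 : ∀ s → comb s (𝟘 , 𝟘) ≡ 𝟘
  comb-𝟘 = from-yes (allVec? {2} λ s → comb s (𝟘 , 𝟘) ≟ 𝟘)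

module _ {U : Pred (V 𝔽₂ 8) 0ℓ} (U-sub : IsSubspace 𝔽₂ U) where
  open IsSubspace U-sub

  𝟘-closed : ι (𝟘 , 𝟘) ∈ U
  𝟘-closed = resp (λ i → sym (lookup-replicate i false)) 0-closed

  ⊕-closed : ∀ x y x′ y′ → ι (x , y) ∈ U → ι (x′ , y′) ∈ U → ι (x ⊕ x′ , y ⊕ y′) ∈ U
  ⊕-closed x y x′ y′ u u′ = resp
    (λ i → trans (sym (lookup-zipWith _xor_ i (x ++ y) (x′ ++ y′)))
                 (cong (λ v → lookup v i) (zipWith-++ _xor_ x y x′ y′)))
    (+-closed u u′)

  ⊙-closed : ∀ α x y → ι (x , y) ∈ U → ι (α ⊙ x , α ⊙ y) ∈ U
  ⊙-closed true  x y u = u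
  ⊙-closed false x y u = 𝟘-closed

  comb-closed : ∀ s x y x′ y′ → ι (x , y) ∈ U → ι (x′ , y′) ∈ U →
                ι (comb s (x , x′) , comb s (y , y′)) ∈ U
  comb-closed (α ∷ β ∷ []) x y x′ y′ u u′ =
    ⊕-closed (α ⊙ x) (α ⊙ y) (β ⊙ x′) (β ⊙ y′) (⊙-closed α x y u) (⊙-closed β x′ y′ u′)

  fibre-line : ∀ p q y → ι (𝟘 , p) ∈ U → ι (𝟘 , q) ∈ U → y ∈ ⟨ p , q ⟩ → ι (𝟘 , y) ∈ U
  fibre-line p q _ p∈U q∈U (s , refl) =
    subst (λ x → ι (x , comb s (p , q)) ∈ U) (comb-𝟘 s) (comb-closed s 𝟘 p 𝟘 q p∈U q∈U)

  graph-line : ∀ f p q x → ι (p , eval f p) ∈ U → ι (q , eval f q) ∈ U →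
               x ∈ ⟨ p , q ⟩ → ι (x , eval f x) ∈ U
  graph-line f p q _ p∈U q∈U (s , refl) =
    subst (λ y → ι (comb s (p , q) , y) ∈ U) (sym (eval-comb f s p q))
      (comb-closed s p (eval f p) q (eval f q) p∈U q∈U)

  -- Subtracting a combination of the two known members moves `(x , y)` into the fibre; adding it
  -- back undoes this reduction in the degenerate cases below.
  fill : ∀ x y x₁ y₁ x₂ y₂ → ((s , _) : x ∈ ⟨ x₁ , x₂ ⟩) → ι (x₁ , y₁) ∈ U → ι (x₂ , y₂) ∈ U →
         ι (𝟘 , y ⊕ comb s (y₁ , y₂)) ∈ U → ι (x , y) ∈ U
  fill x y x₁ y₁ x₂ y₂ (s , refl) u₁ u₂ u =
    subst₂ (λ x y → ι (x , y) ∈ U) (⊕-identityˡ x) (⊕-cancelʳ y (comb s (y₁ , y₂)))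
      (⊕-closed 𝟘 (y ⊕ comb s (y₁ , y₂)) x (comb s (y₁ , y₂)) u (comb-closed s x₁ y₁ x₂ y₂ u₁ u₂))

unit : Fin 4 → W
unit i = 𝟘 [ i ]≔ true

expand : W → W
expand (a ∷ b ∷ c ∷ d ∷ []) =
  comb (a ∷ b ∷ []) (unit 0F , unit 1F) ⊕ comb (c ∷ d ∷ []) (unit 2F , unit 3F)

expand-id : ∀ x → expand x ≡ x
expand-id = from-yes (allW? λ x → expand x ≟ x)

unit-induction : (P : Pred W 0ℓ) → (∀ i → unit i ∈ P) → 𝟘 ∈ P →
                 (∀ {x y} → x ∈ P → y ∈ P → (x ⊕ y) ∈ P) → ∀ x → x ∈ P
unit-induction P P-unit P-𝟘 P-⊕ x@(a ∷ b ∷ c ∷ d ∷ []) = subst P (expand-id x)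
  (P-⊕ (P-⊕ (P-⊙ a 0F) (P-⊙ b 1F)) (P-⊕ (P-⊙ c 2F) (P-⊙ d 3F)))
  where
  P-⊙ : ∀ α i → (α ⊙ unit i) ∈ P
  P-⊙ true  i = P-unit i
  P-⊙ false i = P-𝟘

graphBasis : Poly → Fin 4 → V 𝔽₂ 8
graphBasis f i = ι (unit i , eval f (unit i))

fibreBasis : Fin 4 → V 𝔽₂ 8
fibreBasis i = ι (𝟘 , unit i)

mixedBasis : W × W → W × W → W × W → Fin 4 → V 𝔽₂ 8
mixedBasis (p , q) (y , y′) (u , v) 0F = ι (p , y)
mixedBasis (p , q) (y , y′) (u , v) 1F = ι (q , y′)
mixedBasis (p , q) (y , y′) (u , v) 2F = ι (𝟘 , u)
mixedBasis (p , q) (y , y′) (u , v) 3F = ι (𝟘 , v)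

open import Algebra.Properties.Monoid.Sum (FiniteField.+-monoid 𝔽₂) using (sum)

unit-coefficient : ∀ (c : W) j → sum (λ i → lookup c i ∧ lookup (unit i) j) ≡ lookup c j
unit-coefficient = from-yes (allW? λ c → all? λ j →
  sum (λ i → lookup c i ∧ lookup (unit i) j) ≟ᵇ lookup c j)

-- The first halves of the basis vectors form an identity matrix, so the first four coordinates of a
-- combination are its coefficients.
graphBasis-independent : ∀ f → LinearlyIndependent 𝔽₂ (graphBasis f)
graphBasis-independent f c eq 0F = trans (sym (unit-coefficient (tabulate c) 0F)) (eq 0F)
graphBasis-independent f c eq 1F = trans (sym (unit-coefficient (tabulate c) 1F)) (eq 1F)
graphBasis-independent f c eq 2F = trans (sym (unit-coefficient (tabulate c) 2F)) (eq 2F)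
graphBasis-independent f c eq 3F = trans (sym (unit-coefficient (tabulate c) 3F)) (eq 3F)

fibreBasis-independent : LinearlyIndependent 𝔽₂ fibreBasis
fibreBasis-independent c eq 0F = trans (sym (unit-coefficient (tabulate c) 0F)) (eq 4F)
fibreBasis-independent c eq 1F = trans (sym (unit-coefficient (tabulate c) 1F)) (eq 5F)
fibreBasis-independent c eq 2F = trans (sym (unit-coefficient (tabulate c) 2F)) (eq 6F)
fibreBasis-independent c eq 3F = trans (sym (unit-coefficient (tabulate c) 3F)) (eq 7F)

Independent₂ : W × W → Set
Independent₂ l = ∀ s → comb s l ≡ 𝟘 → s ≡ O ∷ O ∷ []

comb-coordinates : ∀ α β (p q : W) →
  comb (α ∷ β ∷ []) (p , q) ≡ tabulate λ j → (α ∧ lookup p j) xor (β ∧ lookup q j)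
comb-coordinates O O (_ ∷ _ ∷ _ ∷ _ ∷ []) (_ ∷ _ ∷ _ ∷ _ ∷ []) = refl
comb-coordinates O I (_ ∷ _ ∷ _ ∷ _ ∷ []) (_ ∷ _ ∷ _ ∷ _ ∷ []) = refl
comb-coordinates I O (_ ∷ _ ∷ _ ∷ _ ∷ []) (_ ∷ _ ∷ _ ∷ _ ∷ []) = refl
comb-coordinates I I (_ ∷ _ ∷ _ ∷ _ ∷ []) (_ ∷ _ ∷ _ ∷ _ ∷ []) = refl

-- The term `r` is the tail of a four-term sum, contributed by the other two basis vectors or empty.
comb-vanishes : ∀ α β (p q : W) {r} → r ≡ O →
  (∀ j → (α ∧ lookup p j) xor ((β ∧ lookup q j) xor r) ≡ O) → comb (α ∷ β ∷ []) (p , q) ≡ 𝟘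
comb-vanishes α β p q refl eq = trans (comb-coordinates α β p q) (tabulate-cong λ j →
  trans (cong ((α ∧ lookup p j) xor_) (sym (xor-identityʳ (β ∧ lookup q j)))) (eq j))

-- The basis matrix is block triangular: the upper coordinates force the first two coefficients to
-- vanish, and then the lower ones force the last two.
mixedBasis-independent : ∀ {l} g {l′} → Independent₂ l → Independent₂ l′ →
                         LinearlyIndependent 𝔽₂ (mixedBasis l g l′)
mixedBasis-independent {p@(_ ∷ _ ∷ _ ∷ _ ∷ []) , q@(_ ∷ _ ∷ _ ∷ _ ∷ [])} (y , y′) {u , v} l-ind l′-ind c eq =
  λ { 0F → c₀≡O ; 1F → c₁≡O ; 2F → cong head c₂₃≡O ; 3F → cong (head ∘ tail) c₂₃≡O }
  where
  remainder : ∀ γ δ → (γ ∧ O) xor ((δ ∧ O) xor O) ≡ O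
  remainder O O = refl
  remainder O I = refl
  remainder I O = refl
  remainder I I = refl

  upper : ∀ j → (c 0F ∧ lookup p j) xor ((c 1F ∧ lookup q j) xor
                  ((c 2F ∧ O) xor ((c 3F ∧ O) xor O))) ≡ O
  upper 0F = eq 0F
  upper 1F = eq 1F
  upper 2F = eq 2F
  upper 3F = eq 3F

  c₀₁≡O : c 0F ∷ c 1F ∷ [] ≡ O ∷ O ∷ []
  c₀₁≡O = l-ind (c 0F ∷ c 1F ∷ []) (comb-vanishes (c 0F) (c 1F) p q (remainder (c 2F) (c 3F)) upper)

  c₀≡O : c 0F ≡ O
  c₀≡O = cong head c₀₁≡O

  c₁≡O : c 1F ≡ O
  c₁≡O = cong (head ∘ tail) c₀₁≡O

  lower : ∀ j → (c 2F ∧ lookup u j) xor ((c 3F ∧ lookup v j) xor O) ≡ O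
  lower j = subst₂
    (λ α β → (α ∧ lookup y j) xor ((β ∧ lookup y′ j) xor
               ((c 2F ∧ lookup u j) xor ((c 3F ∧ lookup v j) xor O))) ≡ O) c₀≡O c₁≡O (full j)
    where
    full : ∀ j → (c 0F ∧ lookup y j) xor ((c 1F ∧ lookup y′ j) xor
                   ((c 2F ∧ lookup u j) xor ((c 3F ∧ lookup v j) xor O))) ≡ O
    full 0F = eq 4F
    full 1F = eq 5F
    full 2F = eq 6F
    full 3F = eq 7F

  c₂₃≡O : c 2F ∷ c 3F ∷ [] ≡ O ∷ O ∷ []
  c₂₃≡O = l′-ind (c 2F ∷ c 3F ∷ []) (comb-vanishes (c 2F) (c 3F) u v refl lower)

-- 6897 = 16³ + 7 · 5 · 5 · 16 + 1.
Index : Set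
Index = Poly ⊎ ((Fin 7 × Fin 5 × Fin 5) × (Vec Bool 2 × Vec Bool 2)) ⊎ ⊤

-- In the second case `s` and `t` encode a linear map from L to 𝔽₁₆ / M: they choose coset
-- representatives for the images of the two generators of L.
basis : Index → Fin 4 → V 𝔽₂ 8
basis (inj₁ f) = graphBasis f
basis (inj₂ (inj₁ ((c , j , j′) , s , t))) =
  mixedBasis (line c j) (comb s (line c (other j′)) , comb t (line c (other j′))) (line c j′)
basis (inj₂ (inj₂ tt)) = fibreBasis

basis-independent : ∀ i → LinearlyIndependent 𝔽₂ (basis i)
basis-independent (inj₁ f) = graphBasis-independent f
basis-independent (inj₂ (inj₁ ((c , j , j′) , s , t))) =
  mixedBasis-independent _ (line-independent c j) (line-independent c j′)
basis-independent (inj₂ (inj₂ tt)) = fibreBasis-independent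

U : Index → Pred (V 𝔽₂ 8) 0ℓ
U i = span 𝔽₂ (basis i)

U-isSubspace : ∀ i → IsSubspace 𝔽₂ (U i)
U-isSubspace i = span-isSubspace 𝔽₂ (basis i)

opaque
  graph⊆ : ∀ f x → ι (x , eval f x) ∈ U (inj₁ f)
  graph⊆ f = unit-induction (λ x → ι (x , eval f x) ∈ U (inj₁ f))
    (basis-member 𝔽₂ (graphBasis f))
    (subst (λ y → ι (𝟘 , y) ∈ U (inj₁ f)) (sym (eval-𝟘 f)) (𝟘-closed sub))
    (λ {x} {y} x∈ y∈ → subst (λ z → ι (x ⊕ y , z) ∈ U (inj₁ f)) (sym (eval-⊕ f x y))
       (⊕-closed sub x (eval f x) y (eval f y) x∈ y∈))
    where
    sub : IsSubspace 𝔽₂ (U (inj₁ f))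
    sub = U-isSubspace (inj₁ f)

opaque
  fibre⊆ : ∀ y → ι (𝟘 , y) ∈ U (inj₂ (inj₂ tt))
  fibre⊆ = unit-induction (λ y → ι (𝟘 , y) ∈ U (inj₂ (inj₂ tt)))
    (basis-member 𝔽₂ fibreBasis)
    (𝟘-closed sub)
    (λ {x} {y} → ⊕-closed sub 𝟘 x 𝟘 y)
    where
    sub : IsSubspace 𝔽₂ (U (inj₂ (inj₂ tt)))
    sub = U-isSubspace (inj₂ (inj₂ tt))

opaque
  -- The restriction of `f` to L, taken modulo M, is one of the 16 linear maps; it is found from the
  -- cosets of the values of `f` at the generators of L.
  mixed⊆ : ∀ f c j j′ → ∃[ i ] ((∀ x → x ∈ ⟨ line c j ⟩ → ι (x , eval f x) ∈ U i) ×
                                (∀ y → y ∈ ⟨ line c j′ ⟩ → ι (𝟘 , y) ∈ U i))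
  mixed⊆ f c j j′ with complement c j′ (eval f (proj₁ (line c j)))
                      | complement c j′ (eval f (proj₂ (line c j)))
  ... | s , s∈ | t , t∈ = i , (λ x → graph-line sub f p q x (lift p s p∈ s∈) (lift q t q∈ t∈)) , fibre
    where
    i : Index
    i = inj₂ (inj₁ ((c , j , j′) , s , t))
    sub : IsSubspace 𝔽₂ (U i)
    sub = U-isSubspace i
    p q : W
    p = proj₁ (line c j)
    q = proj₂ (line c j)
    rep : Vec Bool 2 → W
    rep s = comb s (line c (other j′))
    p∈ : ι (p , rep s) ∈ U i
    p∈ = basis-member 𝔽₂ (basis i) 0F
    q∈ : ι (q , rep t) ∈ U i
    q∈ = basis-member 𝔽₂ (basis i) 1F
    fibre : ∀ y → y ∈ ⟨ line c j′ ⟩ → ι (𝟘 , y) ∈ U i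
    fibre y = fibre-line sub (proj₁ (line c j′)) (proj₂ (line c j′)) y
      (basis-member 𝔽₂ (basis i) 2F) (basis-member 𝔽₂ (basis i) 3F)
    lift : ∀ x s → ι (x , rep s) ∈ U i → (rep s ⊕ eval f x) ∈ ⟨ line c j′ ⟩ → ι (x , eval f x) ∈ U i
    -- Adding an element of M in the fibre turns the coset representative into the value of `f`.
    lift x s x∈ d∈ = subst₂ (λ x y → ι (x , y) ∈ U i) (⊕-identityʳ x) (⊕-cancelˡ (rep s) (eval f x))
      (⊕-closed sub x (rep s) 𝟘 (rep s ⊕ eval f x) x∈ (fibre _ d∈))

-- Interpolation and the covering of triples of vectors

opaque
  -- Since `f` is 1 at `x`, adding `f` scaled by the error `eval g x ⊕ y` corrects the value there,
  -- while `g` is unchanged at the zeros of `f`.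
  newton-step : ∀ g f x y → eval f x ≡ 𝟙 →
           ∃[ h ] (eval h x ≡ y × (∀ p → eval f p ≡ 𝟘 → eval h p ≡ eval g p))
  newton-step g f x y fx≡𝟙 = h , value , unchanged
    where
    e : W
    e = eval g x ⊕ y
    h : Poly
    h = g ⊞ scale e f
    eval-h : ∀ p → eval h p ≡ eval g p ⊕ e · eval f p
    eval-h p = trans (eval-⊞ g (scale e f) p) (cong (eval g p ⊕_) (eval-scale e f p))
    value : eval h x ≡ y
    value = trans (eval-h x)
      (trans (cong (λ v → eval g x ⊕ e · v) fx≡𝟙)
      (trans (cong (eval g x ⊕_) (·-identityʳ e)) (⊕-cancelˡ (eval g x) y)))
    unchanged : ∀ p → eval f p ≡ 𝟘 → eval h p ≡ eval g p
    unchanged p fp≡𝟘 = trans (eval-h p)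
      (trans (cong (λ v → eval g p ⊕ e · v) fp≡𝟘)
      (trans (cong (eval g p ⊕_) (·-zeroʳ e)) (⊕-identityʳ (eval g p))))

Covered : W × W → W × W → W × W → Set
Covered t₁ t₂ t₃ = ∃[ i ] (ι t₁ ∈ U i × ι t₂ ∈ U i × ι t₃ ∈ U i)

graphed : ∀ i f x y → eval f x ≡ y → ι (x , eval f x) ∈ U i → ι (x , y) ∈ U i
graphed i f x _ refl u = u

zeroPoly : Poly
zeroPoly = 𝟘 , 𝟘 , 𝟘

opaque
  ∈⟨𝟘⟩ : ∀ x → x ∈ ⟨ 𝟘 , 𝟘 ⟩ → x ≡ 𝟘
  ∈⟨𝟘⟩ x (s , refl) = comb-𝟘 s

opaque
  -- The subscript counts the vectors outside the prescribed fibre part. For nonzero `x`, M is a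
  -- line through `p` and `q`, and L is its parallel through `x`.
  cover₁ : ∀ x y p q → Covered (x , y) (𝟘 , p) (𝟘 , q)
  -- Separation from the zero space amounts to `x` being nonzero.
  cover₁ x y p q = [ degenerate , generic ]′ (separate x 𝟘 𝟘)
    where
    degenerate : x ∈ ⟨ 𝟘 , 𝟘 ⟩ → Covered (x , y) (𝟘 , p) (𝟘 , q)
    degenerate x∈ = subst (λ x → Covered (x , y) (𝟘 , p) (𝟘 , q)) (sym (∈⟨𝟘⟩ x x∈))
      (inj₂ (inj₂ tt) , fibre⊆ y , fibre⊆ p , fibre⊆ q)

    generic : Separator x 𝟘 𝟘 → Covered (x , y) (𝟘 , p) (𝟘 , q)
    generic (l , lx , _) =
      let f , fx , _         = newton-step zeroPoly l x y lx
          c , j′ , p∈ , q∈   = line-through p q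
          j , x∈             = parallel-through c x
          i , graph , fibre  = mixed⊆ f c j j′
      in i , graphed i f x y fx (graph x x∈) , fibre p p∈ , fibre q q∈

  -- For independent `x₁` and `x₂`, L is the line through them and M its parallel through `p`;
  -- dependence reduces to `cover₁`.
  cover₂ : ∀ x₁ y₁ x₂ y₂ p → Covered (x₁ , y₁) (x₂ , y₂) (𝟘 , p)
  cover₂ x₁ y₁ x₂ y₂ p =
    [ degenerate₁ , (λ l₁ → [ degenerate₂ , generic l₁ ]′ (separate x₂ x₁ 𝟘)) ]′ (separate x₁ 𝟘 𝟘)
    where
    Goal : W → Set
    Goal x₁ = Covered (x₁ , y₁) (x₂ , y₂) (𝟘 , p)

    degenerate₁ : x₁ ∈ ⟨ 𝟘 , 𝟘 ⟩ → Goal x₁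
    degenerate₁ x₁∈ =
      let i , u₂ , u₁ , u = cover₁ x₂ y₂ y₁ p
      in subst Goal (sym (∈⟨𝟘⟩ x₁ x₁∈)) (i , u₁ , u₂ , u)

    degenerate₂ : x₂ ∈ ⟨ x₁ , 𝟘 ⟩ → Goal x₁
    degenerate₂ x₂∈ =
      -- Modulo `(x₁ , y₁)` the second vector becomes a fibre vector; `fill` restores it.
      let i , u₁ , u₂ , u = cover₁ x₁ y₁ (y₂ ⊕ comb (proj₁ x₂∈) (y₁ , 𝟘)) p
          sub             = U-isSubspace i
      in i , u₁ , fill sub x₂ y₂ x₁ y₁ 𝟘 𝟘 x₂∈ u₁ (𝟘-closed sub) u₂ , u

    generic : Separator x₁ 𝟘 𝟘 → Separator x₂ x₁ 𝟘 → Goal x₁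
    generic (l₁ , l₁x₁ , _) (l₂ , l₂x₂ , l₂x₁ , _) =
      let f , fx₁ , _         = newton-step zeroPoly l₁ x₁ y₁ l₁x₁
          g , gx₂ , g≡f       = newton-step f l₂ x₂ y₂ l₂x₂
          c , j , x₁∈ , x₂∈   = line-through x₁ x₂
          j′ , p∈             = parallel-through c p
          i , graph , fibre   = mixed⊆ g c j j′
      in i , graphed i g x₁ y₁ (trans (g≡f x₁ l₂x₁) fx₁) (graph x₁ x₁∈) ,
             graphed i g x₂ y₂ gx₂ (graph x₂ x₂∈) ,
             fibre p p∈

  -- Three independent projections are met by one graph, as a polynomial has three free
  -- coefficients; each dependence puts a vector into the fibre and reduces to `cover₂`.
  cover₃ : ∀ x₁ y₁ x₂ y₂ x₃ y₃ → Covered (x₁ , y₁) (x₂ , y₂) (x₃ , y₃)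
  cover₃ x₁ y₁ x₂ y₂ x₃ y₃ =
    [ degenerate₁ , (λ l₁ →
    [ degenerate₂ , (λ l₂ →
    [ degenerate₃ , generic l₁ l₂ ]′ (separate x₃ x₁ x₂)) ]′ (separate x₂ x₁ 𝟘)) ]′ (separate x₁ 𝟘 𝟘)
    where
    Goal : W → Set
    Goal x₁ = Covered (x₁ , y₁) (x₂ , y₂) (x₃ , y₃)

    degenerate₁ : x₁ ∈ ⟨ 𝟘 , 𝟘 ⟩ → Goal x₁
    degenerate₁ x₁∈ =
      let i , u₂ , u₃ , u₁ = cover₂ x₂ y₂ x₃ y₃ y₁
      in subst Goal (sym (∈⟨𝟘⟩ x₁ x₁∈)) (i , u₁ , u₂ , u₃)

    degenerate₂ : x₂ ∈ ⟨ x₁ , 𝟘 ⟩ → Goal x₁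
    degenerate₂ x₂∈ =
      let i , u₁ , u₃ , u = cover₂ x₁ y₁ x₃ y₃ (y₂ ⊕ comb (proj₁ x₂∈) (y₁ , 𝟘))
          sub             = U-isSubspace i
      in i , u₁ , fill sub x₂ y₂ x₁ y₁ 𝟘 𝟘 x₂∈ u₁ (𝟘-closed sub) u , u₃

    degenerate₃ : x₃ ∈ ⟨ x₁ , x₂ ⟩ → Goal x₁
    degenerate₃ x₃∈ =
      let i , u₁ , u₂ , u = cover₂ x₁ y₁ x₂ y₂ (y₃ ⊕ comb (proj₁ x₃∈) (y₁ , y₂))
      in i , u₁ , u₂ , fill (U-isSubspace i) x₃ y₃ x₁ y₁ x₂ y₂ x₃∈ u₁ u₂ u

    generic : Separator x₁ 𝟘 𝟘 → Separator x₂ x₁ 𝟘 → Separator x₃ x₁ x₂ → Goal x₁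
    generic (l₁ , l₁x₁ , _) (l₂ , l₂x₂ , l₂x₁ , _) (l₃ , l₃x₃ , l₃x₁ , l₃x₂) =
      -- Each separator vanishes at the earlier points, so the values already prescribed persist.
      let f , fx₁ , _   = newton-step zeroPoly l₁ x₁ y₁ l₁x₁
          g , gx₂ , g≡f = newton-step f l₂ x₂ y₂ l₂x₂
          h , hx₃ , h≡g = newton-step g l₃ x₃ y₃ l₃x₃
          i             = inj₁ h
      in i , graphed i h x₁ y₁ (trans (h≡g x₁ l₃x₁) (trans (g≡f x₁ l₂x₁) fx₁)) (graph⊆ h x₁) ,
             graphed i h x₂ y₂ (trans (h≡g x₂ l₃x₂) gx₂) (graph⊆ h x₂) ,
             graphed i h x₃ y₃ hx₃ (graph⊆ h x₃)

-- Enumeration of the index set and the bound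

bits↔ : ∀ n → Fin (2 ^ n) ↔ Vec Bool n
bits↔ zero    = mk↔ₛ′ (λ _ → []) (λ _ → 0F) (λ { [] → refl }) (λ { 0F → refl ; (suc ()) })
bits↔ (suc n) =
  mk↔ₛ′ (uncurry _∷_) (λ { (x ∷ xs) → x , xs }) (λ { (x ∷ xs) → refl }) (λ _ → refl)
  ↔-∘ ((2↔Bool ×-↔ bits↔ n) ↔-∘ *↔×)

index↔ : Fin 6897 ↔ Index
index↔ = ((W↔ ×↔ (W↔ ×↔ W↔)) ⊎↔
          (((↔-id (Fin 7) ×↔ (↔-id (Fin 5) ×↔ ↔-id (Fin 5))) ×↔ (bits↔ 2 ×↔ bits↔ 2)) ⊎↔ 1↔⊤))
  where
  infixr 2 _×↔_
  infixr 1 _⊎↔_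
  _×↔_ : ∀ {m n} {A B : Set} → Fin m ↔ A → Fin n ↔ B → Fin (m ℕ.* n) ↔ (A × B)
  A↔ ×↔ B↔ = (A↔ ×-↔ B↔) ↔-∘ *↔×
  _⊎↔_ : ∀ {m n} {A B : Set} → Fin m ↔ A → Fin n ↔ B → Fin (m ℕ.+ n) ↔ (A ⊎ B)
  A↔ ⊎↔ B↔ = (A↔ ⊎-↔ B↔) ↔-∘ +↔⊎
  W↔ : Fin 16 ↔ W
  W↔ = bits↔ 4

upperHalf lowerHalf : V 𝔽₂ 8 → W
upperHalf d = tabulate λ j → d (j ↑ˡ 4)
lowerHalf d = tabulate λ j → d (4 ↑ʳ j)

ι-halves : ∀ d j → ι (upperHalf d , lowerHalf d) j ≡ d j
ι-halves d 0F = refl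
ι-halves d 1F = refl
ι-halves d 2F = refl
ι-halves d 3F = refl
ι-halves d 4F = refl
ι-halves d 5F = refl
ι-halves d 6F = refl
ι-halves d 7F = refl

basisCovering : BasisCovering 𝔽₂ 8 4 3 6897
basisCovering = reindex 𝔽₂ 8 4 3 index↔ basis basis-independent covers
  where
  covers : CoversIndependent 𝔽₂ 8 4 3 basis
  covers d _ =
    let i , u₁ , u₂ , u₃ = cover₃ (upperHalf (d 0F)) (lowerHalf (d 0F))
                                  (upperHalf (d 1F)) (lowerHalf (d 1F))
                                  (upperHalf (d 2F)) (lowerHalf (d 2F))
        open IsSubspace (U-isSubspace i)
    in i , λ { 0F → resp (ι-halves (d 0F)) u₁
             ; 1F → resp (ι-halves (d 1F)) u₂
             ; 2F → resp (ι-halves (d 2F)) u₃ }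

mainTheorem13 : ∃[ m ] (IsCoveringNumber 𝔽₂ 8 4 3 m × m ≤ 6897)
mainTheorem13 = basisCovering⇒coveringNumber≤ 𝔽₂ 8 4 3 basisCovering
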